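{- Let $k,k'\geq 1$ be arbitrary natural numbers. The following statements hold, where "FC of order $k|\ell$" and "the Frankl conjecture" denote the assertions defined in the context. (1) If FC of order $k|1$ and FC of order $k'|1$ are both valid, then FC of order $k+k'|1$ is valid. In particular, if the Frankl conjecture is valid, then FC of order $k|1$ is valid. (2) If FC of order $k|k$ and FC of order $k'|k'$ are both valid, then FC of order $k+k'|k+k'$ is valid. In particular, if the Frankl conjecture is valid, then FC of order $k|k$ is valid.
   Context: For a finite nonempty set $X$, a union-closed family on $X$ is a set $\mathcal{A}\subseteq\mathcal{P}(X)$ of subsets of $X$ such that $\emptyset,X\in\mathcal{A}$, and such that $A_1,A_2\in\mathcal{A}$ implies $A_1\cup A_2\in\mathcal{A}$. If $\mathcal{A}$ is a union-closed family on $X$, then $X$ is denoted by $\cup\mathcal{A}$. The class of all union-closed families on finite nonempty sets is denoted by $\mathfrak{A}$. $|S|$ denotes the cardinality of a set $S$. The Frankl conjecture is the assertion: if $\mathcal{A}$ is a union-closed family on a finite nonempty set $X$, then there exists $x\in X$ such that $x$ belongs to at least half of the members of $\mathcal{A}$. Let $k,\ell$ be natural numbers with $k\geq\ell\geq1$. A family $\mathcal{A}\in\mathfrak{A}$ is called $k|\ell$-separated if $|\cup\mathcal{A}|\geq k$ and for every $k$ distinct elements $x_1,\ldots,x_k\in\cup\mathcal{A}$ there exists $A\in\mathcal{A}$ such that $x_1,\ldots,x_\ell\in A$ and $\{x_{\ell+1},\ldots,x_k\}\cap A=\emptyset$. The class of all $k|\ell$-separated union-closed families is denoted by $\mathfrak{A}_{k|\ell}$.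 For natural numbers $k\geq\ell\geq1$, $\mathfrak{c}_{k|\ell}$ is the supremum of all positive real numbers $\epsilon$ satisfying the following condition: for every $\mathcal{A}\in\mathfrak{A}_{k|\ell}$ there exists a set $S\subseteq\cup\mathcal{A}$ with $|S|=k$ such that there are at least $\epsilon|\mathcal{A}|$ members $A$ of $\mathcal{A}$ satisfying $|S\cap A|\geq\ell$. If there is no such $\epsilon$, then $\mathfrak{c}_{k|\ell}:=0$. For natural numbers $k\geq\ell\geq1$, FC of order $k|\ell$ is the assertion: for every $\mathcal{A}\in\mathfrak{A}_{k|\ell}$ there exists a subset $S\subseteq\cup\mathcal{A}$ with $|S|=k$ such that the number of those members $A$ of $\mathcal{A}$ with $|A\cap S|\geq\ell$ is at least $\left(2^{ -k}\sum_{i=\ell}^k\binom{k}{i}\right)|\mathcal{A}|$; in other words, $\mathfrak{c}_{k|\ell}=2^{ -k}\sum_{i=\ell}^k\binom{k}{i}$. -}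

module Defs where

open import Data.Fin.Base using (Fin; toℕ)
open import Data.Fin.Subset using (Subset; ⊥; ∣_∣; _∈_; _∉_; _⊆_; _∩_; _∪_; Nonempty)
open import Data.Fin.Subset.Properties using (_∈?_)
open import Data.Integer.Base using (+_)
open import Data.List.Base using (List; length; filter; applyUpTo)
import Data.List.Membership.Propositional as List
open import Data.List.Relation.Unary.Unique.Propositional using (Unique)
open import Data.Nat.Base using (ℕ; suc; _+_; _∸_; _^_; _≤_; _<_)
open import Data.Nat.ListAction using (sum)
open import Data.Nat.Combinatorics using (_C_)
open import Data.Nat.Properties using (_≤?_; m^n≢0)
open import Data.Product.Base using (∃-syntax; _×_)
open import Data.Rational.Base as ℚ using (ℚ; ½)
open import Function.Definitions using (Injective)
open import Relation.Binary.PropositionalEquality.Core using (_≡_)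
open import Relation.Unary using (Pred; Decidable)

-- Finite sets X are represented as subsets of some Fin n, and a set of
-- subsets of X as a duplicate-free list.  Since X is a member and contains
-- every member, X is the union of the family.
record UnionClosedFamily (n : ℕ) : Set where
  field
    ⋃           : Subset n
    members     : List (Subset n)
    ⋃-nonempty  : Nonempty ⋃
    unique      : Unique members
    members-⊆-⋃ : ∀ {A} → A List.∈ members → A ⊆ ⋃
    ∅-member    : ⊥ List.∈ members
    ⋃-member    : ⋃ List.∈ members
    ∪-closed    : ∀ {A B} → A List.∈ members → B List.∈ members →
                  (A ∪ B) List.∈ members

open UnionClosedFamily public

private
  variable
    n : ℕ

ℕ→ℚ : ℕ → ℚ
ℕ→ℚ m = + m ℚ./ 1

size : UnionClosedFamily n → ℕ
size 𝒜 = length (members 𝒜)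

count : ∀ {p} {P : Pred (Subset n) p} → Decidable P → UnionClosedFamily n → ℕ
count P? 𝒜 = length (filter P? (members 𝒜))

FranklConjecture : Set
FranklConjecture =
  ∀ {n} (𝒜 : UnionClosedFamily n) →
  ∃[ x ] (x ∈ ⋃ 𝒜 × ½ ℚ.* ℕ→ℚ (size 𝒜) ℚ.≤ ℕ→ℚ (count (x ∈?_) 𝒜))

-- The elements x₁, …, x_k are indexed from 0, so that x₁, …, x_ℓ are those
-- with index below ℓ.
Separated : (k ℓ : ℕ) → UnionClosedFamily n → Set
Separated {n} k ℓ 𝒜 =
  k ≤ ∣ ⋃ 𝒜 ∣ ×
  ((x : Fin k → Fin n) → Injective _≡_ _≡_ x → (∀ i → x i ∈ ⋃ 𝒜) →
   ∃[ A ] (A List.∈ members 𝒜 ×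
           (∀ i → toℕ i < ℓ → x i ∈ A) ×
           (∀ i → ℓ ≤ toℕ i → x i ∉ A)))

-- 2⁻ᵏ · Σ_{i=ℓ}^{k} (k choose i)
binomialTail : (k ℓ : ℕ) → ℚ
binomialTail k ℓ = + sum (applyUpTo (λ j → k C (ℓ + j)) (suc k ∸ ℓ)) ℚ./ (2 ^ k)
  where instance _ = m^n≢0 2 k

FC : (k ℓ : ℕ) → Set
FC k ℓ =
  ∀ {n} (𝒜 : UnionClosedFamily n) → Separated k ℓ 𝒜 →
  ∃[ S ] (S ⊆ ⋃ 𝒜 × ∣ S ∣ ≡ k ×
          binomialTail k ℓ ℚ.* ℕ→ℚ (size 𝒜) ℚ.≤
            ℕ→ℚ (count (λ A → ℓ ≤? ∣ A ∩ S ∣) 𝒜))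

{-# OPTIONS --safe #-}
-- For k|1, choose S for 𝒜 and keep the members of 𝒜 disjoint from S: by
-- separation they form a separated family on ⋃ 𝒜 ─ S, and they are at most a
-- 2⁻ᵏ-fraction of 𝒜.  For k|k, keep instead the members containing S, with S
-- removed from each.  In both cases a set S′ chosen for the new family gives
-- S ∪ S′ for 𝒜, and the bounds multiply.
module Submission where

open import Defs
open import Data.Bool.Properties as Bool using ()
open import Data.Fin.Base using (Fin; zero; suc)
open import Data.Fin.Properties using (suc-injective; toℕ<n)
open import Data.Fin.Subset hiding (⋃)
open import Data.Fin.Subset.Properties
open import Data.Integer.Base as ℤ using (+_)
import Data.Integer.Properties as ℤ
open import Data.List.Base as List
  using (List; []; _∷_; length; filter; applyUpTo; _∷ʳ_; allFin; deduplicate)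
open import Data.List.Membership.Propositional.Properties
  using (∈-filter⁺; ∈-filter⁻; ∈-map⁺; ∈-map⁻; ∈-allFin; ∈-deduplicate⁺; ∈-deduplicate⁻)
import Data.List.Membership.Propositional as List
open import Data.List.Properties using (applyUpTo-∷ʳ; filter-notAll)
import Data.List.Relation.Unary.All as All
open import Data.List.Relation.Unary.AllPairs using ([]; _∷_)
open import Data.List.Relation.Unary.Any using (here; there)
open import Data.List.Relation.Unary.Unique.DecPropositional.Properties using (deduplicate-!)
open import Data.List.Relation.Unary.Unique.Propositional using (Unique)
import Data.List.Relation.Unary.Unique.Propositional.Properties as Unique
open import Data.Nat.Base as ℕ
  using (ℕ; zero; suc; NonZero; _+_; _*_; _∸_; _^_; _≤_; _<_; z≤n; s≤s)
open import Data.Nat.Combinatorics using (_C_; nCn≡1; nCk≡nC[n∸k]; k>n⇒nCk≡0; nCk+nC[k+1]≡[n+1]C[k+1])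
open import Data.Nat.ListAction using (sum)
open import Data.Nat.ListAction.Properties using (sum-++)
import Data.Nat.Properties as ℕ
open import Data.Nat.Tactic.RingSolver using (solve-∀)
open import Data.Product.Base using (∃-syntax; _×_; _,_; proj₁; proj₂; uncurry)
import Data.Rational.Base as ℚ
import Data.Rational.Properties as ℚ
import Data.Rational.Unnormalised.Base as ℚᵘ
import Data.Rational.Unnormalised.Properties as ℚᵘ
open import Data.Sum.Base using (inj₁; inj₂; [_,_]′)
open import Data.Vec.Base using ([]; _∷_; here; there)
import Data.Vec.Functional as Vector
open import Data.Vec.Properties using (≡-dec)
open import Function.Base using (_∘_; id)
open import Function.Bundles using (_⇔_; mk⇔; module Equivalence)
open import Function.Definitions using (Injective)
open import Relation.Binary.Definitions using (DecidableEquality)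
open import Relation.Binary.PropositionalEquality
open import Relation.Nullary using (¬_; yes; no; ¬?; contradiction)
open import Relation.Unary using (Decidable)

private
  variable
    n m k k′ : ℕ
    A B : Set
    p q : Subset n
    x : Fin n

_≟_ : DecidableEquality (Subset n)
_≟_ = ≡-dec Bool._≟_

-- Finite counting

-- Induction on `xs`: deleting the value `f x` from `ys` keeps the images of the tail, by
-- injectivity, and strictly shortens `ys`.
length-injection : DecidableEquality B → (f : A → B) {xs : List A} {ys : List B} → Unique xs →
  (∀ {x} → x List.∈ xs → f x List.∈ ys) →
  (∀ {x y} → x List.∈ xs → y List.∈ xs → f x ≡ f y → x ≡ y) →
  length xs ≤ length ys
length-injection _≟ᴮ_ f {[]} _ _ _ = z≤n
length-injection _≟ᴮ_ f {x ∷ xs} {ys} (x∉xs ∷ xs!) maps inj = ℕ.≤-<-trans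
  (length-injection _≟ᴮ_ f xs!
    (λ y∈xs → ∈-filter⁺ (λ b → ¬? (b ≟ᴮ f x)) (maps (there y∈xs))
      (λ fy≡fx → All.lookup x∉xs y∈xs (sym (inj (there y∈xs) (here refl) fy≡fx))))
    (λ y∈xs z∈xs → inj (there y∈xs) (there z∈xs)))
  (filter-notAll (λ b → ¬? (b ≟ᴮ f x)) ys (List.lose (maps (here refl)) (λ ne → ne refl)))

length-filter-≤ : ∀ {P Q : A → Set} (P? : Decidable P) (Q? : Decidable Q) →
  DecidableEquality A → {xs ys : List A} → Unique xs →
  (∀ {x} → x List.∈ xs → P x → x List.∈ ys × Q x) →
  length (filter P? xs) ≤ length (filter Q? ys)
length-filter-≤ P? Q? _≟ᴬ_ xs! h = length-injection _≟ᴬ_ id (Unique.filter⁺ P? xs!)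
  (λ x∈ → let x∈xs , px = ∈-filter⁻ P? x∈ ; x∈ys , qx = h x∈xs px in ∈-filter⁺ Q? x∈ys qx)
  (λ _ _ → id)

length-filter-¬ : ∀ {P : A → Set} (P? : Decidable P) (xs : List A) →
  length (filter P? xs) + length (filter (¬? ∘ P?) xs) ≡ length xs
length-filter-¬ P? [] = refl
length-filter-¬ P? (x ∷ xs) with P? x
... | yes _ = cong suc (length-filter-¬ P? xs)
... | no  _ = trans (ℕ.+-suc _ _) (cong suc (length-filter-¬ P? xs))

-- Finite subsets

x∈p─q⇒x∉q : ∀ (p q : Subset n) → x ∈ p ─ q → x ∉ q
x∈p─q⇒x∉q (_ ∷ _) (inside  ∷ _) (there x∈) (there x∈q) = x∈p─q⇒x∉q _ _ x∈ x∈q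
x∈p─q⇒x∉q (_ ∷ _) (outside ∷ _) (there x∈) (there x∈q) = x∈p─q⇒x∉q _ _ x∈ x∈q

∣p∩q∣+∣p─q∣≡∣p∣ : ∀ (p q : Subset n) → ∣ p ∩ q ∣ + ∣ p ─ q ∣ ≡ ∣ p ∣
∣p∩q∣+∣p─q∣≡∣p∣ [] [] = refl
∣p∩q∣+∣p─q∣≡∣p∣ (outside ∷ p) (outside ∷ q) = ∣p∩q∣+∣p─q∣≡∣p∣ p q
∣p∩q∣+∣p─q∣≡∣p∣ (outside ∷ p) (inside  ∷ q) = ∣p∩q∣+∣p─q∣≡∣p∣ p q
∣p∩q∣+∣p─q∣≡∣p∣ (inside  ∷ p) (outside ∷ q) = trans (ℕ.+-suc _ _) (cong suc (∣p∩q∣+∣p─q∣≡∣p∣ p q))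
∣p∩q∣+∣p─q∣≡∣p∣ (inside  ∷ p) (inside  ∷ q) = cong suc (∣p∩q∣+∣p─q∣≡∣p∣ p q)

∣p∪q∣≡∣p∣+∣q─p∣ : ∀ (p q : Subset n) → ∣ p ∪ q ∣ ≡ ∣ p ∣ + ∣ q ─ p ∣
∣p∪q∣≡∣p∣+∣q─p∣ [] [] = refl
∣p∪q∣≡∣p∣+∣q─p∣ (outside ∷ p) (outside ∷ q) = ∣p∪q∣≡∣p∣+∣q─p∣ p q
∣p∪q∣≡∣p∣+∣q─p∣ (outside ∷ p) (inside  ∷ q) = trans (cong suc (∣p∪q∣≡∣p∣+∣q─p∣ p q)) (sym (ℕ.+-suc _ _))
∣p∪q∣≡∣p∣+∣q─p∣ (inside  ∷ p) (outside ∷ q) = cong suc (∣p∪q∣≡∣p∣+∣q─p∣ p q)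
∣p∪q∣≡∣p∣+∣q─p∣ (inside  ∷ p) (inside  ∷ q) = cong suc (∣p∪q∣≡∣p∣+∣q─p∣ p q)

∣p∪q∣≤∣p∣+∣q∣ : ∀ (p q : Subset n) → ∣ p ∪ q ∣ ≤ ∣ p ∣ + ∣ q ∣
∣p∪q∣≤∣p∣+∣q∣ p q rewrite ∣p∪q∣≡∣p∣+∣q─p∣ p q = ℕ.+-monoʳ-≤ ∣ p ∣ (∣p─q∣≤∣p∣ q p)

disjoint⇒p─q≡p : (∀ {x} → x ∈ p → x ∉ q) → p ─ q ≡ p
disjoint⇒p─q≡p {p = p} {q} dis =
  ⊆-antisym (p─q⊆p p q) (λ x∈p → x∈p∧x∉q⇒x∈p─q x∈p (dis x∈p))

∣p∪q∣-disjoint : (∀ {x} → x ∈ q → x ∉ p) → ∣ p ∪ q ∣ ≡ ∣ p ∣ + ∣ q ∣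
∣p∪q∣-disjoint {q = q} {p} dis =
  trans (∣p∪q∣≡∣p∣+∣q─p∣ p q) (cong (λ r → ∣ p ∣ + ∣ r ∣) (disjoint⇒p─q≡p dis))

p⊆q⇒q∩p≡p : p ⊆ q → q ∩ p ≡ p
p⊆q⇒q∩p≡p {p = p} {q} p⊆q = ⊆-antisym (p∩q⊆q q p) (λ x∈p → x∈p∩q⁺ (p⊆q x∈p , x∈p))

∣q─p∣-⊆ : p ⊆ q → ∣ p ∣ + ∣ q ─ p ∣ ≡ ∣ q ∣
∣q─p∣-⊆ {p = p} {q} p⊆q =
  trans (cong (λ r → ∣ r ∣ + ∣ q ─ p ∣) (sym (p⊆q⇒q∩p≡p p⊆q))) (∣p∩q∣+∣p─q∣≡∣p∣ q p)

m≤∣q─p∣ : p ⊆ q → ∣ p ∣ ≡ k → k + m ≤ ∣ q ∣ → m ≤ ∣ q ─ p ∣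
m≤∣q─p∣ {p = p} p⊆q refl le = ℕ.+-cancelˡ-≤ ∣ p ∣ _ _ (subst (_ ≤_) (sym (∣q─p∣-⊆ p⊆q)) le)

suc∣p-x∣≡∣p∣ : x ∈ p → suc ∣ p - x ∣ ≡ ∣ p ∣
suc∣p-x∣≡∣p∣ {x = x} {p} x∈p = subst (λ s → s + ∣ p - x ∣ ≡ ∣ p ∣) (∣⁅x⁆∣≡1 x)
  (∣q─p∣-⊆ λ y∈ → subst (_∈ p) (sym (x∈⁅y⁆⇒x≡y x y∈)) x∈p)

-- Together with `p∪q─q` this makes removing and adjoining a fixed set inverse to each other,
-- between sets containing it and sets disjoint from it. The counting for `k|k` rests on this.
p∪q─p : p ⊆ q → (q ─ p) ∪ p ≡ q
p∪q─p {p = p} {q} p⊆q = ⊆-antisym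
  ([ p─q⊆p q p , p⊆q ]′ ∘ x∈p∪q⁻ (q ─ p) p)
  split
  where
  split : q ⊆ (q ─ p) ∪ p
  split {x} x∈q with x ∈? p
  ... | yes x∈p = x∈p∪q⁺ (inj₂ x∈p)
  ... | no  x∉p = x∈p∪q⁺ (inj₁ (x∈p∧x∉q⇒x∈p─q x∈q x∉p))

p∪q─q : (∀ {x} → x ∈ p → x ∉ q) → (p ∪ q) ─ q ≡ p
p∪q─q {p = p} {q} dis = ⊆-antisym
  (λ x∈ → [ id , (λ x∈q → contradiction x∈q (x∈p─q⇒x∉q (p ∪ q) q x∈)) ]′
    (x∈p∪q⁻ p q (p─q⊆p (p ∪ q) q x∈)))
  (λ x∈p → x∈p∧x∉q⇒x∈p─q (x∈p∪q⁺ (inj₁ x∈p)) (dis x∈p))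

∪-─-distrib : ∀ (p q r : Subset n) → (p ∪ q) ─ r ≡ (p ─ r) ∪ (q ─ r)
∪-─-distrib [] [] [] = refl
∪-─-distrib (_ ∷ p) (_ ∷ q) (outside ∷ r) = cong (_ ∷_) (∪-─-distrib p q r)
∪-─-distrib (_ ∷ p) (_ ∷ q) (inside  ∷ r) = cong (_ ∷_) (∪-─-distrib p q r)

Nonempty⇒0<∣p∣ : Nonempty p → 0 < ∣ p ∣
Nonempty⇒0<∣p∣ (x , x∈p) = ℕ.≤-<-trans z≤n (x∈p⇒∣p-x∣<∣p∣ x∈p)

0<∣p∣⇒Nonempty : 0 < ∣ p ∣ → Nonempty p
0<∣p∣⇒Nonempty {n} {p} 0<∣p∣ with nonempty? p
... | yes ne = ne
... | no  em = contradiction (trans (cong ∣_∣ (Empty-unique em)) (∣⊥∣≡0 n)) (ℕ.>⇒≢ 0<∣p∣)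

∣q∣≤∣p∩q∣⇒q⊆p : ∀ (p q : Subset n) → ∣ q ∣ ≤ ∣ p ∩ q ∣ → q ⊆ p
∣q∣≤∣p∩q∣⇒q⊆p p q le {x} x∈q with x ∈? p
... | yes x∈p = x∈p
... | no  x∉p = contradiction
  (p⊂q⇒∣p∣<∣q∣ (p∩q⊆q p q , x , x∈q , x∉p ∘ proj₁ ∘ x∈p∩q⁻ p q)) (ℕ.≤⇒≯ le)

-- A greedy choice: an element of `q` outside `p` is dropped whenever enough elements remain after
-- it.
intermediate : ∀ (p q : Subset n) → p ⊆ q → ∣ p ∣ ≤ m → m ≤ ∣ q ∣ →
  ∃[ r ] (p ⊆ r × r ⊆ q × ∣ r ∣ ≡ m)
intermediate [] [] _ z≤n z≤n = [] , id , id , refl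
intermediate (outside ∷ p) (outside ∷ q) p⊆q lo hi =
  let r , p⊆r , r⊆q , eq = intermediate p q (drop-∷-⊆ p⊆q) lo hi
  in outside ∷ r , s⊆s p⊆r , s⊆s r⊆q , eq
intermediate {m = m} (outside ∷ p) (inside ∷ q) p⊆q lo hi with m ℕ.≤? ∣ q ∣
... | yes m≤ =
  let r , p⊆r , r⊆q , eq = intermediate p q (drop-∷-⊆ p⊆q) lo m≤
  in outside ∷ r , s⊆s p⊆r , out⊆ r⊆q , eq
-- Here `m` must equal `suc ∣ q ∣`, so everything left is taken.
... | no m≰ = inside ∷ q , p⊆q , id , ℕ.≤-antisym (ℕ.≰⇒> m≰) hi
intermediate (inside ∷ p) (outside ∷ q) p⊆q lo hi = contradiction (p⊆q here) λ ()
intermediate (inside ∷ p) (inside ∷ q) p⊆q (s≤s lo) (s≤s hi) =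
  let r , p⊆r , r⊆q , eq = intermediate p q (drop-∷-⊆ p⊆q) lo hi
  in inside ∷ r , s⊆s p⊆r , s⊆s r⊆q , cong suc eq

enumerate : (p : Subset n) → Fin ∣ p ∣ → Fin n
enumerate (outside ∷ p) i       = suc (enumerate p i)
enumerate (inside  ∷ p) zero    = zero
enumerate (inside  ∷ p) (suc i) = suc (enumerate p i)

enumerate-∈ : ∀ (p : Subset n) i → enumerate p i ∈ p
enumerate-∈ (outside ∷ p) i       = there (enumerate-∈ p i)
enumerate-∈ (inside  ∷ p) zero    = here
enumerate-∈ (inside  ∷ p) (suc i) = there (enumerate-∈ p i)

enumerate-injective : ∀ (p : Subset n) → Injective _≡_ _≡_ (enumerate p)
enumerate-injective (outside ∷ p) eq = enumerate-injective p (suc-injective eq)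
enumerate-injective (inside  ∷ p) {zero}  {zero}  eq = refl
enumerate-injective (inside  ∷ p) {suc i} {suc j} eq =
  cong suc (enumerate-injective p (suc-injective eq))

enumerate-surjective : ∀ (p : Subset n) → x ∈ p → ∃[ i ] (enumerate p i ≡ x)
enumerate-surjective (inside  ∷ p) here = zero , refl
enumerate-surjective (outside ∷ p) (there x∈p) =
  let i , eq = enumerate-surjective p x∈p in i , cong suc eq
enumerate-surjective (inside  ∷ p) (there x∈p) =
  let i , eq = enumerate-surjective p x∈p in suc i , cong suc eq

image : (Fin k → Fin n) → Subset n
image {zero}  f = ⊥
image {suc k} f = ⁅ f zero ⁆ ∪ image (f ∘ suc)

∣image∣≤ : ∀ (f : Fin k → Fin n) → ∣ image f ∣ ≤ k
∣image∣≤ {zero}  {n} f = ℕ.≤-reflexive (∣⊥∣≡0 n)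
∣image∣≤ {suc k} f = ℕ.≤-trans (∣p∪q∣≤∣p∣+∣q∣ ⁅ f zero ⁆ (image (f ∘ suc)))
  (ℕ.+-mono-≤ (ℕ.≤-reflexive (∣⁅x⁆∣≡1 (f zero))) (∣image∣≤ (f ∘ suc)))

image⁺ : ∀ (f : Fin k → Fin n) i → f i ∈ image f
image⁺ f zero    = x∈p∪q⁺ (inj₁ (x∈⁅x⁆ (f zero)))
image⁺ f (suc i) = x∈p∪q⁺ (inj₂ (image⁺ (f ∘ suc) i))

image⁻ : ∀ (f : Fin k → Fin n) → x ∈ image f → ∃[ i ] (x ≡ f i)
image⁻ {zero}  f x∈ = contradiction x∈ ∉⊥
image⁻ {suc k} f x∈ with x∈p∪q⁻ ⁅ f zero ⁆ (image (f ∘ suc)) x∈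
... | inj₁ x∈₁ = zero , x∈⁅y⁆⇒x≡y (f zero) x∈₁
... | inj₂ x∈₂ = let i , eq = image⁻ (f ∘ suc) x∈₂ in suc i , eq

-- Separation

-- The inequality (rather than suc ∣ T ∣ ≡ k) makes this monotone in k.
SeparatesPoints : ℕ → UnionClosedFamily n → Set
SeparatesPoints k 𝒜 = ∀ x T → x ∈ ⋃ 𝒜 → T ⊆ ⋃ 𝒜 → x ∉ T → suc ∣ T ∣ ≤ k →
  ∃[ A ] (A List.∈ members 𝒜 × x ∈ A × (∀ {y} → y ∈ T → y ∉ A))

cons-injective : ∀ (f : Fin m → Fin n) → Injective _≡_ _≡_ f → (∀ i → f i ≢ x) →
  Injective _≡_ _≡_ (x Vector.∷ f)
cons-injective f inj ≢x {zero}  {zero}  eq = refl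
cons-injective f inj ≢x {zero}  {suc j} eq = contradiction (sym eq) (≢x j)
cons-injective f inj ≢x {suc i} {zero}  eq = contradiction eq (≢x i)
cons-injective f inj ≢x {suc i} {suc j} eq = cong suc (inj eq)

-- `Separated` speaks of exactly `k` distinct points, so `T` is first enlarged inside `⋃ 𝒜 - x` to a
-- set `T′` that together with `x` has `k` elements; the size condition on `⋃ 𝒜` leaves room for
-- this. The point `x` is listed first because index 0 is the only one below 1.
separated⇒separatesPoints : (𝒜 : UnionClosedFamily n) → Separated k 1 𝒜 → SeparatesPoints k 𝒜
separated⇒separatesPoints {k = suc k} 𝒜 (k≤ , sep) x T x∈ T⊆ x∉T (s≤s ∣T∣≤k)
  with T′ , T⊆T′ , T′⊆ , refl ← intermediate T (⋃ 𝒜 - x)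
         (λ y∈T → x∈p∧x≢y⇒x∈p-y (T⊆ y∈T) λ { refl → x∉T y∈T }) ∣T∣≤k
         (ℕ.s≤s⁻¹ (subst (suc k ≤_) (sym (suc∣p-x∣≡∣p∣ x∈)) k≤))
  = let
      x∉T′ = λ x∈T′ → x∈p─q⇒x∉q (⋃ 𝒜) ⁅ x ⁆ (T′⊆ x∈T′) (x∈⁅x⁆ x)
      A , A∈ , in-A , out-A = sep (x Vector.∷ enumerate T′)
        (cons-injective (enumerate T′) (enumerate-injective T′)
          λ { i refl → x∉T′ (enumerate-∈ T′ i) })
        λ { zero → x∈ ; (suc i) → p─q⊆p (⋃ 𝒜) ⁅ x ⁆ (T′⊆ (enumerate-∈ T′ i)) }
    in A , A∈ , in-A zero (s≤s z≤n) , λ y∈T →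
      let i , eq = enumerate-surjective T′ (T⊆T′ y∈T)
      in subst (_∉ A) eq (out-A (suc i) (s≤s z≤n))

-- The first point plays the role of `x` and the image of the others that of `T`; injectivity keeps
-- the first point out of that image.
separatesPoints⇒separated : 1 ≤ k → (𝒜 : UnionClosedFamily n) → k ≤ ∣ ⋃ 𝒜 ∣ →
  SeparatesPoints k 𝒜 → Separated k 1 𝒜
separatesPoints⇒separated (s≤s _) 𝒜 k≤ sep = k≤ , λ f f-inj f∈ →
  let A , A∈ , f₀∈A , disj = sep (f zero) (image (f ∘ suc)) (f∈ zero)
        (λ y∈ → let i , eq = image⁻ (f ∘ suc) y∈ in subst (_∈ ⋃ 𝒜) (sym eq) (f∈ (suc i)))
        (λ f₀∈ → let i , eq = image⁻ (f ∘ suc) f₀∈ in contradiction (f-inj eq) λ ())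
        (s≤s (∣image∣≤ (f ∘ suc)))
  in A , A∈ , (λ { zero _ → f₀∈A ; (suc _) (s≤s ()) }) , λ { (suc i) _ → disj (image⁺ (f ∘ suc) i) }

-- With `ℓ = k` there is no point to avoid, so the whole ground set is a witness.
separated-kk : (𝒜 : UnionClosedFamily n) → k ≤ ∣ ⋃ 𝒜 ∣ → Separated k k 𝒜
separated-kk 𝒜 k≤ = k≤ , λ f _ f∈ → ⋃ 𝒜 , ⋃-member 𝒜 , (λ i _ → f∈ i) ,
  λ i k≤i → contradiction (toℕ<n i) (ℕ.≤⇒≯ k≤i)

-- Derived families

-- `Y` is the union of the members chosen for its points. `partial` forms this union along a list of
-- points, starting from the member `⊥`, and is then applied to all of `Fin n`.
covered⇒member : (𝒜 : UnionClosedFamily n) (Y : Subset n) →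
  (∀ {x} → x ∈ Y → ∃[ A ] (A List.∈ members 𝒜 × x ∈ A × A ⊆ Y)) → Y List.∈ members 𝒜
covered⇒member {n} 𝒜 Y cover =
  let A , A∈ , A⊆Y , ⊆A = partial (allFin n)
  in subst (List._∈ members 𝒜) (⊆-antisym A⊆Y (⊆A (∈-allFin _))) A∈
  where
  partial : ∀ xs → ∃[ A ] (A List.∈ members 𝒜 × A ⊆ Y × (∀ {x} → x List.∈ xs → x ∈ Y → x ∈ A))
  partial [] = ⊥ , ∅-member 𝒜 , ⊥⊆ , λ ()
  partial (x ∷ xs) with A , A∈ , A⊆Y , ⊆A ← partial xs | x ∈? Y
  ... | no x∉Y = A , A∈ , A⊆Y , λ { (here refl) x∈Y → contradiction x∈Y x∉Y ; (there y∈) → ⊆A y∈ }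
  ... | yes x∈Y = let B , B∈ , x∈B , B⊆Y = cover x∈Y in
    A ∪ B , ∪-closed 𝒜 A∈ B∈ , ([ A⊆Y , B⊆Y ]′ ∘ x∈p∪q⁻ A B) ,
    λ { (here refl) _ → x∈p∪q⁺ (inj₂ x∈B) ; (there y∈) y∈Y → x∈p∪q⁺ (inj₁ (⊆A y∈ y∈Y)) }

meets? : (S A : Subset n) → _
meets? S A = 1 ℕ.≤? ∣ A ∩ S ∣

misses : Subset n → UnionClosedFamily n → List (Subset n)
misses S 𝒜 = filter (¬? ∘ meets? S) (members 𝒜)

disjoint⇒¬meets : (S A : Subset n) → (∀ {x} → x ∈ A → x ∉ S) → ¬ 1 ≤ ∣ A ∩ S ∣
disjoint⇒¬meets S A dis 1≤ =
  let x , x∈ = 0<∣p∣⇒Nonempty 1≤ ; x∈A , x∈S = x∈p∩q⁻ A S x∈ in dis x∈A x∈S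

¬meets⇒disjoint : (S A : Subset n) → ¬ 1 ≤ ∣ A ∩ S ∣ → ∀ {x} → x ∈ A → x ∉ S
¬meets⇒disjoint S A ¬1≤ x∈A x∈S = ¬1≤ (Nonempty⇒0<∣p∣ (_ , x∈p∩q⁺ (x∈A , x∈S)))

∈-misses⁺ : ∀ S (𝒜 : UnionClosedFamily n) {A} → A List.∈ members 𝒜 →
  (∀ {x} → x ∈ A → x ∉ S) → A List.∈ misses S 𝒜
∈-misses⁺ S 𝒜 {A} A∈ dis = ∈-filter⁺ (¬? ∘ meets? S) A∈ (disjoint⇒¬meets S A dis)

∈-misses⁻ : ∀ S (𝒜 : UnionClosedFamily n) {A} → A List.∈ misses S 𝒜 →
  A List.∈ members 𝒜 × (∀ {x} → x ∈ A → x ∉ S)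
∈-misses⁻ S 𝒜 {A} A∈ =
  let A∈𝒜 , ¬meets = ∈-filter⁻ (¬? ∘ meets? S) A∈ in A∈𝒜 , ¬meets⇒disjoint S A ¬meets

-- That `⋃ 𝒜 ─ S` is a member does not follow from union-closure; separation has to supply it.
avoid : (𝒜 : UnionClosedFamily n) (S : Subset n) → Nonempty (⋃ 𝒜 ─ S) →
  (⋃ 𝒜 ─ S) List.∈ members 𝒜 → UnionClosedFamily n
avoid 𝒜 S ne X─S∈ = record
  { ⋃           = ⋃ 𝒜 ─ S
  ; members     = misses S 𝒜
  ; ⋃-nonempty  = ne
  ; unique      = Unique.filter⁺ (¬? ∘ meets? S) (unique 𝒜)
  ; members-⊆-⋃ = λ A∈ x∈A → let A∈𝒜 , dis = ∈-misses⁻ S 𝒜 A∈ in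
      x∈p∧x∉q⇒x∈p─q (members-⊆-⋃ 𝒜 A∈𝒜 x∈A) (dis x∈A)
  ; ∅-member    = ∈-misses⁺ S 𝒜 (∅-member 𝒜) (λ x∈⊥ → contradiction x∈⊥ ∉⊥)
  ; ⋃-member    = ∈-misses⁺ S 𝒜 X─S∈ (x∈p─q⇒x∉q (⋃ 𝒜) S)
  ; ∪-closed    = λ {A} {B} A∈ B∈ →
      let A∈𝒜 , disA = ∈-misses⁻ S 𝒜 A∈ ; B∈𝒜 , disB = ∈-misses⁻ S 𝒜 B∈ in
      ∈-misses⁺ S 𝒜 (∪-closed 𝒜 A∈𝒜 B∈𝒜) ([ disA , disB ]′ ∘ x∈p∪q⁻ A B)
  }

remainders : Subset n → UnionClosedFamily n → List (Subset n)
remainders S 𝒜 = ⊥ ∷ List.map (_─ S) (filter (S ⊆?_) (members 𝒜))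

-- A duplicate arises when `S` is itself a member: then `⊥` occurs a second time, as `S ─ S`.
traces : Subset n → UnionClosedFamily n → List (Subset n)
traces S 𝒜 = deduplicate _≟_ (remainders S 𝒜)

-- Membership in `traces S 𝒜` as an inductive predicate, so that its uses become case distinctions
-- on the origin of a set.
data Trace (S : Subset n) (𝒜 : UnionClosedFamily n) : Subset n → Set where
  empty : Trace S 𝒜 ⊥
  trace : ∀ {A} → A List.∈ members 𝒜 → S ⊆ A → Trace S 𝒜 (A ─ S)

∈-traces⁺ : ∀ S (𝒜 : UnionClosedFamily n) {B} → Trace S 𝒜 B → B List.∈ traces S 𝒜
∈-traces⁺ S 𝒜 empty = ∈-deduplicate⁺ _≟_ {remainders S 𝒜} (here refl)
∈-traces⁺ S 𝒜 (trace A∈ S⊆A) =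
  ∈-deduplicate⁺ _≟_ {remainders S 𝒜} (there (∈-map⁺ (_─ S) (∈-filter⁺ (S ⊆?_) A∈ S⊆A)))

∈-traces⁻ : ∀ S (𝒜 : UnionClosedFamily n) {B} → B List.∈ traces S 𝒜 → Trace S 𝒜 B
∈-traces⁻ S 𝒜 B∈ with ∈-deduplicate⁻ _≟_ (remainders S 𝒜) B∈
... | here refl = empty
... | there B∈ with A , A∈ , refl ← ∈-map⁻ (_─ S) B∈ =
  uncurry trace (∈-filter⁻ (S ⊆?_) A∈)

-- The empty set is added because S itself need not be a member of 𝒜.
contract : (𝒜 : UnionClosedFamily n) (S : Subset n) → S ⊆ ⋃ 𝒜 → Nonempty (⋃ 𝒜 ─ S) →
  UnionClosedFamily n
contract 𝒜 S S⊆ ne = record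
  { ⋃           = ⋃ 𝒜 ─ S
  ; members     = traces S 𝒜
  ; ⋃-nonempty  = ne
  ; unique      = deduplicate-! _≟_ (remainders S 𝒜)
  ; members-⊆-⋃ = bounded ∘ ∈-traces⁻ S 𝒜
  ; ∅-member    = ∈-traces⁺ S 𝒜 empty
  ; ⋃-member    = ∈-traces⁺ S 𝒜 (trace (⋃-member 𝒜) S⊆)
  ; ∪-closed    = λ A∈ B∈ → ∈-traces⁺ S 𝒜 (union (∈-traces⁻ S 𝒜 A∈) (∈-traces⁻ S 𝒜 B∈))
  }
  where
  bounded : ∀ {B} → Trace S 𝒜 B → B ⊆ ⋃ 𝒜 ─ S
  bounded empty = ⊥⊆
  bounded (trace {A} A∈ _) x∈ =
    x∈p∧x∉q⇒x∈p─q (members-⊆-⋃ 𝒜 A∈ (p─q⊆p A S x∈)) (x∈p─q⇒x∉q A S x∈)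
  union : ∀ {B C} → Trace S 𝒜 B → Trace S 𝒜 C → Trace S 𝒜 (B ∪ C)
  union {C = C} empty tC = subst (Trace S 𝒜) (sym (∪-identityˡ C)) tC
  union {B} tB empty = subst (Trace S 𝒜) (sym (∪-identityʳ B)) tB
  union (trace {A} A∈ S⊆A) (trace {B} B∈ S⊆B) = subst (Trace S 𝒜) (∪-─-distrib A B S)
    (trace (∪-closed 𝒜 A∈ B∈) (x∈p∪q⁺ ∘ inj₁ ∘ S⊆A))

-- Numerical forms of the assertions

-- Quotients in `ℚ` are reduced to lowest terms, so the inequality is moved to the unnormalised
-- rationals, where it is cross-multiplication.
ratio-≤⇔ : ∀ a d m c .{{_ : NonZero d}} →
  ((+ a ℚ./ d) ℚ.* ℕ→ℚ m ℚ.≤ ℕ→ℚ c) ⇔ (a * m ≤ c * d)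
ratio-≤⇔ a d@(suc d-1) m c = mk⇔ to from
  where
  lhs = (+ a ℚᵘ./ d) ℚᵘ.* (+ m ℚᵘ./ 1)
  lhs≃ : ℚ.toℚᵘ ((+ a ℚ./ d) ℚ.* ℕ→ℚ m) ℚᵘ.≃ lhs
  lhs≃ = ℚᵘ.≃-trans (ℚ.toℚᵘ-homo-* (+ a ℚ./ d) (ℕ→ℚ m))
    (ℚᵘ.*-cong (ℚ.toℚᵘ-fromℚᵘ (ℚᵘ.mkℚᵘ (+ a) d-1)) (ℚ.toℚᵘ-fromℚᵘ (ℚᵘ.mkℚᵘ (+ m) 0)))
  rhs≃ : ℚ.toℚᵘ (ℕ→ℚ c) ℚᵘ.≃ (+ c ℚᵘ./ 1)
  rhs≃ = ℚ.toℚᵘ-fromℚᵘ (ℚᵘ.mkℚᵘ (+ c) 0)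
  numˡ : (+ a ℤ.* + m) ℤ.* + 1 ≡ + (a * m)
  numˡ = trans (ℤ.*-identityʳ _) (sym (ℤ.pos-* a m))
  numʳ : + c ℤ.* + (d * 1) ≡ + (c * d)
  numʳ = trans (sym (ℤ.pos-* c (d * 1))) (cong (λ e → + (c * e)) (ℕ.*-identityʳ d))
  to : (+ a ℚ./ d) ℚ.* ℕ→ℚ m ℚ.≤ ℕ→ℚ c → a * m ≤ c * d
  to le = ℤ.drop‿+≤+ (subst₂ ℤ._≤_ numˡ numʳ (ℚᵘ.drop-*≤*
    (ℚᵘ.≤-respˡ-≃ lhs≃ (ℚᵘ.≤-respʳ-≃ rhs≃ (ℚ.toℚᵘ-mono-≤ le)))))
  from : a * m ≤ c * d → (+ a ℚ./ d) ℚ.* ℕ→ℚ m ℚ.≤ ℕ→ℚ c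
  from le = ℚ.toℚᵘ-cancel-≤ (ℚᵘ.≤-respˡ-≃ (ℚᵘ.≃-sym lhs≃) (ℚᵘ.≤-respʳ-≃ (ℚᵘ.≃-sym rhs≃)
    (ℚᵘ.*≤* (subst₂ ℤ._≤_ (sym numˡ) (sym numʳ) (ℤ.+≤+ le)))))

sum-applyUpTo-+ : ∀ {f g h : ℕ → ℕ} → (∀ j → f j + g j ≡ h j) → ∀ m →
  sum (applyUpTo f m) + sum (applyUpTo g m) ≡ sum (applyUpTo h m)
sum-applyUpTo-+ eq zero = refl
sum-applyUpTo-+ {f} {g} eq (suc m) = trans
  (interchange (f 0) _ (g 0) _)
  (cong₂ _+_ (eq 0) (sum-applyUpTo-+ (eq ∘ suc) m))
  where open import Algebra.Properties.CommutativeSemigroup ℕ.+-commutativeSemigroup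

sum-applyUpTo-suc : ∀ (f : ℕ → ℕ) m → sum (applyUpTo f (suc m)) ≡ sum (applyUpTo f m) + f m
sum-applyUpTo-suc f m = begin
  sum (applyUpTo f (suc m))            ≡⟨ cong sum (applyUpTo-∷ʳ f m) ⟨
  sum (applyUpTo f m ∷ʳ f m)           ≡⟨ sum-++ (applyUpTo f m) (f m ∷ []) ⟩
  sum (applyUpTo f m) + (f m + 0)      ≡⟨ cong (sum (applyUpTo f m) ℕ.+_) (ℕ.+-identityʳ (f m)) ⟩
  sum (applyUpTo f m) + f m            ∎
  where open ≡-Reasoning

nC0≡1 : ∀ n → n C 0 ≡ 1
nC0≡1 n = trans (nCk≡nC[n∸k] {0} {n} z≤n) (nCn≡1 n)

-- The row sum of Pascal's triangle, with `k C 0 = 1` split off as the `suc`; what remains is the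
-- numerator of `binomialTail k 1`. Pascal's rule turns row `suc k` into two copies of row `k`.
binomialSum : ∀ k → suc (sum (applyUpTo (λ j → k C suc j) k)) ≡ 2 ^ k
binomialSum zero = refl
binomialSum (suc k) = begin
  suc (sum (applyUpTo (λ j → suc k C suc j) (suc k)))
    ≡⟨ cong suc (sum-applyUpTo-+ {k C_} {λ j → k C suc j} (nCk+nC[k+1]≡[n+1]C[k+1] k) (suc k)) ⟨
  suc (sum (applyUpTo (k C_) (suc k)) + sum (applyUpTo (λ j → k C suc j) (suc k)))
    -- The first sum has the extra leading term `k C 0 = 1`; the second runs one term too far, and
    -- that term `k C suc k` vanishes.
    ≡⟨ cong suc (cong₂ _+_ (cong (ℕ._+ T) (nC0≡1 k))
         (trans (sum-applyUpTo-suc (λ j → k C suc j) k)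
           (trans (cong (T ℕ.+_) (k>n⇒nCk≡0 (ℕ.n<1+n k))) (ℕ.+-identityʳ T)))) ⟩
  suc (suc T + T)          ≡⟨ double T ⟩
  2 * suc T                ≡⟨ cong (2 *_) (binomialSum k) ⟩
  2 ^ suc k                ∎
  where
  open ≡-Reasoning
  T = sum (applyUpTo (λ j → k C suc j) k)
  double : ∀ t → suc (suc t + t) ≡ 2 * suc t
  double = solve-∀

-- The constant is `1 - 2⁻ᵏ`, so passing to the complement leaves the bound `2⁻ᵏ` for the members
-- that miss `S`.
tail-1⇔ : ∀ k (𝒜 : UnionClosedFamily n) S →
  (binomialTail k 1 ℚ.* ℕ→ℚ (size 𝒜) ℚ.≤ ℕ→ℚ (count (λ A → 1 ℕ.≤? ∣ A ∩ S ∣) 𝒜)) ⇔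
  (2 ^ k * length (misses S 𝒜) ≤ size 𝒜)
tail-1⇔ k 𝒜 S = mk⇔ (to ∘ ratio.to) (ratio.from ∘ from)
  where
  T = sum (applyUpTo (λ j → k C suc j) k)
  c = count (meets? S) 𝒜
  μ = length (misses S 𝒜)
  module ratio = Equivalence (ratio-≤⇔ T (2 ^ k) (size 𝒜) c {{ℕ.m^n≢0 2 k}})
  split : c + μ ≡ size 𝒜
  split = length-filter-¬ (meets? S) (members 𝒜)
  expandˡ : ∀ T c m → T * (c + m) ≡ c * T + T * m
  expandˡ = solve-∀
  expandʳ : ∀ T c → c * suc T ≡ c * T + c
  expandʳ = solve-∀
  -- With `size 𝒜 = c + μ` and `2 ^ k = suc T`, cancelling `c * T` leaves `T * μ ≤ c`; adding `μ`
  -- gives the claim. `from` runs the same steps backwards.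
  to : T * size 𝒜 ≤ c * 2 ^ k → 2 ^ k * μ ≤ size 𝒜
  to le = subst₂ _≤_ (trans (ℕ.+-comm (T * μ) μ) (cong (_* μ) (binomialSum k))) split
    (ℕ.+-monoˡ-≤ μ (ℕ.+-cancelˡ-≤ (c * T) _ _
      (subst₂ _≤_ (trans (cong (T *_) (sym split)) (expandˡ T c μ))
        (trans (cong (c *_) (sym (binomialSum k))) (expandʳ T c)) le)))
  from : 2 ^ k * μ ≤ size 𝒜 → T * size 𝒜 ≤ c * 2 ^ k
  from le = subst₂ _≤_ (sym (trans (cong (T *_) (sym split)) (expandˡ T c μ)))
    (sym (trans (cong (c *_) (sym (binomialSum k))) (expandʳ T c)))
    (ℕ.+-monoʳ-≤ (c * T) (ℕ.+-cancelʳ-≤ μ _ _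
      (subst₂ _≤_ (trans (cong (_* μ) (sym (binomialSum k))) (ℕ.+-comm μ (T * μ))) (sym split) le)))

-- The sum consists of the single term `k C k = 1`, so the constant is `2⁻ᵏ`.
tail-k⇔ : ∀ k N c → (binomialTail k k ℚ.* ℕ→ℚ N ℚ.≤ ℕ→ℚ c) ⇔ (N ≤ 2 ^ k * c)
tail-k⇔ k N c = subst₂ (λ x y → (binomialTail k k ℚ.* ℕ→ℚ N ℚ.≤ ℕ→ℚ c) ⇔ (x ≤ y))
  (trans (cong (_* N) only-term) (ℕ.*-identityˡ N)) (ℕ.*-comm c (2 ^ k))
  (ratio-≤⇔ (sum (applyUpTo (λ j → k C (k + j)) (suc k ∸ k))) (2 ^ k) N c {{ℕ.m^n≢0 2 k}})
  where
  only-term : sum (applyUpTo (λ j → k C (k + j)) (suc k ∸ k)) ≡ 1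
  only-term rewrite ℕ.m+n∸n≡m 1 k | ℕ.+-identityʳ k | nCn≡1 k = refl

-- The conclusion of `FC k 1` in complementary form, with denominators cleared; in this form the
-- bounds for two families multiply.
RarelyMissed : ℕ → UnionClosedFamily n → Set
RarelyMissed k 𝒜 = ∃[ S ] (S ⊆ ⋃ 𝒜 × ∣ S ∣ ≡ k × 2 ^ k * length (misses S 𝒜) ≤ size 𝒜)

FC-1⇒misses : FC k 1 → (𝒜 : UnionClosedFamily n) → Separated k 1 𝒜 → RarelyMissed k 𝒜
FC-1⇒misses {k} fc 𝒜 sep =
  let S , S⊆ , ∣S∣ , le = fc 𝒜 sep in S , S⊆ , ∣S∣ , Equivalence.to (tail-1⇔ k 𝒜 S) le

misses⇒FC-1 : (∀ {n} (𝒜 : UnionClosedFamily n) → Separated k 1 𝒜 → RarelyMissed k 𝒜) → FC k 1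
misses⇒FC-1 {k} f 𝒜 sep =
  let S , S⊆ , ∣S∣ , le = f 𝒜 sep in S , S⊆ , ∣S∣ , Equivalence.from (tail-1⇔ k 𝒜 S) le

contains? : ∀ k (S A : Subset n) → _
contains? k S A = k ℕ.≤? ∣ A ∩ S ∣

OftenContained : ℕ → UnionClosedFamily n → Set
OftenContained k 𝒜 = ∃[ S ] (S ⊆ ⋃ 𝒜 × ∣ S ∣ ≡ k × size 𝒜 ≤ 2 ^ k * count (contains? k S) 𝒜)

FC-diag⇒contained : FC k k → (𝒜 : UnionClosedFamily n) → Separated k k 𝒜 → OftenContained k 𝒜
FC-diag⇒contained {k} fc 𝒜 sep =
  let S , S⊆ , ∣S∣ , le = fc 𝒜 sep
  in S , S⊆ , ∣S∣ , Equivalence.to (tail-k⇔ k (size 𝒜) (count (contains? k S) 𝒜)) le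

contained⇒FC-diag : (∀ {n} (𝒜 : UnionClosedFamily n) → Separated k k 𝒜 → OftenContained k 𝒜) → FC k k
contained⇒FC-diag {k} f 𝒜 sep =
  let S , S⊆ , ∣S∣ , le = f 𝒜 sep
  in S , S⊆ , ∣S∣ , Equivalence.from (tail-k⇔ k (size 𝒜) (count (contains? k S) 𝒜)) le

-- From the Frankl conjecture to order 1|1

frankl⇒FC-11 : FranklConjecture → FC 1 1
frankl⇒FC-11 frankl 𝒜 _ =
  let x , x∈ , half = frankl 𝒜
      size≤ = Equivalence.to (ratio-≤⇔ 1 2 (size 𝒜) (count (x ∈?_) 𝒜)) half
      count≤ = length-filter-≤ (x ∈?_) (meets? ⁅ x ⁆) _≟_ (unique 𝒜) λ A∈ x∈A →
        A∈ , Nonempty⇒0<∣p∣ (x , x∈p∩q⁺ (x∈A , x∈⁅x⁆ x))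
  in ⁅ x ⁆ , (λ y∈ → subst (_∈ ⋃ 𝒜) (sym (x∈⁅y⁆⇒x≡y x y∈)) x∈) , ∣⁅x⁆∣≡1 x ,
     -- `binomialTail 1 1` computes to one half.
     Equivalence.from (ratio-≤⇔ 1 2 (size 𝒜) (count (meets? ⁅ x ⁆) 𝒜))
       (ℕ.≤-trans size≤ (ℕ.*-monoˡ-≤ 2 count≤))

-- Adding orders of the form k|1

misses-+ : 1 ≤ k′ →
  (∀ {n} (ℬ : UnionClosedFamily n) → Separated k′ 1 ℬ → RarelyMissed k′ ℬ) →
  ∀ {n} (𝒜 : UnionClosedFamily n) → k + k′ ≤ ∣ ⋃ 𝒜 ∣ → SeparatesPoints (k + k′) 𝒜 →
  RarelyMissed k 𝒜 → RarelyMissed (k + k′) 𝒜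
misses-+ {k′} {k} 1≤k′ fc′ 𝒜 k+k′≤ sep (S , S⊆ , ∣S∣ , bound-S) = extend
  where
  -- Each point outside `S` lies in a member disjoint from `S`: since `k′` is positive, `S` and one
  -- further point stay within the `k + k′` points that can be separated.
  X─S∈ : (⋃ 𝒜 ─ S) List.∈ members 𝒜
  X─S∈ = covered⇒member 𝒜 (⋃ 𝒜 ─ S) λ {x} x∈ →
    let A , A∈ , x∈A , disj = sep x S (p─q⊆p (⋃ 𝒜) S x∈) S⊆ (x∈p─q⇒x∉q (⋃ 𝒜) S x∈)
          (subst (λ s → suc s ≤ k + k′) (sym ∣S∣) (ℕ.m<m+n k 1≤k′))
    in A , A∈ , x∈A , λ y∈A → x∈p∧x∉q⇒x∈p─q (members-⊆-⋃ 𝒜 A∈ y∈A) (λ y∈S → disj y∈S y∈A)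

  k′≤∣X─S∣ : k′ ≤ ∣ ⋃ 𝒜 ─ S ∣
  k′≤∣X─S∣ = m≤∣q─p∣ S⊆ ∣S∣ k+k′≤

  ℬ = avoid 𝒜 S (0<∣p∣⇒Nonempty (ℕ.≤-trans 1≤k′ k′≤∣X─S∣)) X─S∈

  -- Separating `x` from `S ∪ T` in `𝒜` gives a member that avoids `S`, hence one of `ℬ`; the set
  -- `S` uses up exactly `k` of the `k + k′` points.
  sep-ℬ : SeparatesPoints k′ ℬ
  sep-ℬ x T x∈ T⊆ x∉T ∣T∣< =
    let A , A∈ , x∈A , disj = sep x (S ∪ T) (p─q⊆p (⋃ 𝒜) S x∈)
          ([ S⊆ , p─q⊆p (⋃ 𝒜) S ∘ T⊆ ]′ ∘ x∈p∪q⁻ S T)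
          ([ x∈p─q⇒x∉q (⋃ 𝒜) S x∈ , x∉T ]′ ∘ x∈p∪q⁻ S T)
          (ℕ.≤-trans (s≤s (∣p∪q∣≤∣p∣+∣q∣ S T))
            (subst (λ s → suc (s + ∣ T ∣) ≤ k + k′) (sym ∣S∣)
              (subst (_≤ k + k′) (ℕ.+-suc k ∣ T ∣) (ℕ.+-monoʳ-≤ k ∣T∣<))))
    in A , ∈-misses⁺ S 𝒜 A∈ (λ y∈A y∈S → disj (x∈p∪q⁺ (inj₁ y∈S)) y∈A) , x∈A ,
       λ y∈T → disj (x∈p∪q⁺ (inj₂ y∈T))

  extend : RarelyMissed (k + k′) 𝒜
  extend with S′ , S′⊆ , ∣S′∣ , bound-S′ ← fc′ ℬ (separatesPoints⇒separated 1≤k′ ℬ k′≤∣X─S∣ sep-ℬ)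
    = S ∪ S′ , ([ S⊆ , p─q⊆p (⋃ 𝒜) S ∘ S′⊆ ]′ ∘ x∈p∪q⁻ S S′) ,
      trans (∣p∪q∣-disjoint (x∈p─q⇒x∉q (⋃ 𝒜) S ∘ S′⊆)) (cong₂ _+_ ∣S∣ ∣S′∣) ,
      bound
    where
    open ℕ.≤-Reasoning
    fewer : length (misses (S ∪ S′) 𝒜) ≤ length (misses S′ ℬ)
    fewer = length-filter-≤ (¬? ∘ meets? (S ∪ S′)) (¬? ∘ meets? S′) _≟_ (unique 𝒜) λ {A} A∈ ¬meets →
      let dis = ¬meets⇒disjoint (S ∪ S′) A ¬meets in
      ∈-misses⁺ S 𝒜 A∈ (λ x∈A → dis x∈A ∘ x∈p∪q⁺ ∘ inj₁) ,
      disjoint⇒¬meets S′ A (λ x∈A → dis x∈A ∘ x∈p∪q⁺ ∘ inj₂)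
    bound : 2 ^ (k + k′) * length (misses (S ∪ S′) 𝒜) ≤ size 𝒜
    bound = begin
      2 ^ (k + k′) * length (misses (S ∪ S′) 𝒜)
        ≡⟨ cong (_* length (misses (S ∪ S′) 𝒜)) (ℕ.^-distribˡ-+-* 2 k k′) ⟩
      2 ^ k * 2 ^ k′ * length (misses (S ∪ S′) 𝒜)
        ≡⟨ ℕ.*-assoc (2 ^ k) (2 ^ k′) _ ⟩
      2 ^ k * (2 ^ k′ * length (misses (S ∪ S′) 𝒜))
        ≤⟨ ℕ.*-monoʳ-≤ (2 ^ k) (ℕ.*-monoʳ-≤ (2 ^ k′) fewer) ⟩
      2 ^ k * (2 ^ k′ * length (misses S′ ℬ))
        -- `misses S 𝒜` is the member list of `ℬ`, so its length is `size ℬ`.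
        ≤⟨ ℕ.*-monoʳ-≤ (2 ^ k) bound-S′ ⟩
      2 ^ k * length (misses S 𝒜)
        ≤⟨ bound-S ⟩
      size 𝒜 ∎

-- Monotonicity of `SeparatesPoints` makes a `(k + k′)|1`-separated family also `k|1`-separated, so
-- `FC k 1` supplies the first set.
FC-1-+ : 1 ≤ k → 1 ≤ k′ → FC k 1 → FC k′ 1 → FC (k + k′) 1
FC-1-+ {k} {k′} 1≤k 1≤k′ fc fc′ = misses⇒FC-1 λ 𝒜 sep-𝒜 →
  let k+k′≤ = proj₁ sep-𝒜
      sep = separated⇒separatesPoints 𝒜 sep-𝒜
  in misses-+ 1≤k′ (FC-1⇒misses fc′) 𝒜 k+k′≤ sep
    (FC-1⇒misses fc 𝒜 (separatesPoints⇒separated 1≤k 𝒜 (ℕ.≤-trans (ℕ.m≤m+n k k′) k+k′≤)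
      λ x T x∈ T⊆ x∉T ∣T∣< → sep x T x∈ T⊆ x∉T (ℕ.≤-trans ∣T∣< (ℕ.m≤m+n k k′))))

-- Adding orders of the form k|k

contained-+ : 1 ≤ k′ →
  (∀ {n} (ℬ : UnionClosedFamily n) → Separated k′ k′ ℬ → OftenContained k′ ℬ) →
  ∀ {n} (𝒜 : UnionClosedFamily n) → k + k′ ≤ ∣ ⋃ 𝒜 ∣ → OftenContained k 𝒜 → OftenContained (k + k′) 𝒜
contained-+ {k′} {k} 1≤k′ fc′ {n} 𝒜 k+k′≤ (S , S⊆ , ∣S∣ , bound-S) = extend
  where
  k′≤∣X─S∣ : k′ ≤ ∣ ⋃ 𝒜 ─ S ∣
  k′≤∣X─S∣ = m≤∣q─p∣ S⊆ ∣S∣ k+k′≤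

  ℬ = contract 𝒜 S S⊆ (0<∣p∣⇒Nonempty (ℕ.≤-trans 1≤k′ k′≤∣X─S∣))

  contains : ∀ {A} → k ≤ ∣ A ∩ S ∣ → S ⊆ A
  contains {A} k≤ = ∣q∣≤∣p∩q∣⇒q⊆p A S (subst (_≤ ∣ A ∩ S ∣) (sym ∣S∣) k≤)

  -- Removing `S` is injective on sets containing `S`, as adjoining it again undoes it. Equality can
  -- fail because of the added empty set.
  count≤size : count (contains? k S) 𝒜 ≤ size ℬ
  count≤size = length-injection _≟_ (_─ S) (Unique.filter⁺ (contains? k S) (unique 𝒜))
    (λ A∈ → let A∈𝒜 , k≤ = ∈-hits A∈ in ∈-traces⁺ S 𝒜 (trace A∈𝒜 (contains k≤)))
    (λ A∈ B∈ eq → trans (sym (p∪q─p (contains (proj₂ (∈-hits A∈)))))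
      (trans (cong (_∪ S) eq) (p∪q─p (contains (proj₂ (∈-hits B∈))))))
    where
    ∈-hits : ∀ {A} → A List.∈ filter (contains? k S) (members 𝒜) →
      A List.∈ members 𝒜 × k ≤ ∣ A ∩ S ∣
    ∈-hits = ∈-filter⁻ (contains? k S)

  extend : OftenContained (k + k′) 𝒜
  extend with S′ , S′⊆ , ∣S′∣ , bound-S′ ← fc′ ℬ (separated-kk ℬ k′≤∣X─S∣)
    = S ∪ S′ , ([ S⊆ , p─q⊆p (⋃ 𝒜) S ∘ S′⊆ ]′ ∘ x∈p∪q⁻ S S′) , ∣S∪S′∣ , bound
    where
    open ℕ.≤-Reasoning
    c′ = count (contains? k′ S′) ℬ
    c″ = count (contains? (k + k′) (S ∪ S′)) 𝒜
    ∣S∪S′∣ : ∣ S ∪ S′ ∣ ≡ k + k′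
    ∣S∪S′∣ = trans (∣p∪q∣-disjoint (x∈p─q⇒x∉q (⋃ 𝒜) S ∘ S′⊆)) (cong₂ _+_ ∣S∣ ∣S′∣)

    -- The added empty set does no harm: as `k′` is positive, it is never counted, so every counted
    -- set comes from a member of `𝒜`.
    adjoin-S : ∀ {B} → Trace S 𝒜 B → k′ ≤ ∣ B ∩ S′ ∣ →
      (B ∪ S) List.∈ members 𝒜 × k + k′ ≤ ∣ (B ∪ S) ∩ (S ∪ S′) ∣
    adjoin-S empty k′≤ = contradiction
      (ℕ.≤-trans 1≤k′ (ℕ.≤-trans k′≤ (∣p∩q∣≤∣p∣ ⊥ S′)))
      (ℕ.<⇒≱ (s≤s (ℕ.≤-reflexive (∣⊥∣≡0 n))))
    adjoin-S {B} (trace {A} A∈ S⊆A) k′≤ =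
      subst (List._∈ members 𝒜) (sym (p∪q─p S⊆A)) A∈ ,
      ℕ.≤-reflexive (sym (trans (cong ∣_∣ (p⊆q⇒q∩p≡p S∪S′⊆)) ∣S∪S′∣))
      where
      S∪S′⊆ : S ∪ S′ ⊆ B ∪ S
      S∪S′⊆ = [ x∈p∪q⁺ ∘ inj₂
              , x∈p∪q⁺ ∘ inj₁ ∘ ∣q∣≤∣p∩q∣⇒q⊆p B S′ (subst (_≤ ∣ B ∩ S′ ∣) (sym ∣S′∣) k′≤)
              ]′ ∘ x∈p∪q⁻ S S′

    -- Adjoining `S` is injective here because the members of `ℬ` are disjoint from `S`.
    more : c′ ≤ c″
    more = length-injection _≟_ (_∪ S) (Unique.filter⁺ (contains? k′ S′) (unique ℬ))
      (λ B∈ → let B∈ℬ , k′≤ = ∈-filter⁻ (contains? k′ S′) B∈ in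
        uncurry (∈-filter⁺ (contains? (k + k′) (S ∪ S′))) (adjoin-S (∈-traces⁻ S 𝒜 B∈ℬ) k′≤))
      (λ B∈ C∈ eq → trans (sym (p∪q─q (avoids B∈))) (trans (cong (_─ S) eq) (p∪q─q (avoids C∈))))
      where
      avoids : ∀ {B x} → B List.∈ filter (contains? k′ S′) (members ℬ) → x ∈ B → x ∉ S
      avoids B∈ x∈B = x∈p─q⇒x∉q (⋃ 𝒜) S (members-⊆-⋃ ℬ (proj₁ (∈-filter⁻ (contains? k′ S′) B∈)) x∈B)

    bound : size 𝒜 ≤ 2 ^ (k + k′) * c″
    bound = begin
      size 𝒜                                        ≤⟨ bound-S ⟩
      2 ^ k * count (contains? k S) 𝒜      ≤⟨ ℕ.*-monoʳ-≤ (2 ^ k) count≤size ⟩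
      2 ^ k * size ℬ                                ≤⟨ ℕ.*-monoʳ-≤ (2 ^ k) bound-S′ ⟩
      2 ^ k * (2 ^ k′ * c′)                         ≤⟨ ℕ.*-monoʳ-≤ (2 ^ k) (ℕ.*-monoʳ-≤ (2 ^ k′) more) ⟩
      2 ^ k * (2 ^ k′ * c″)                         ≡⟨ ℕ.*-assoc (2 ^ k) (2 ^ k′) c″ ⟨
      2 ^ k * 2 ^ k′ * c″                           ≡⟨ cong (_* c″) (ℕ.^-distribˡ-+-* 2 k k′) ⟨
      2 ^ (k + k′) * c″                             ∎

FC-diag-+ : 1 ≤ k′ → FC k k → FC k′ k′ → FC (k + k′) (k + k′)
FC-diag-+ {k′} {k} 1≤k′ fc fc′ = contained⇒FC-diag λ 𝒜 sep →
  contained-+ 1≤k′ (FC-diag⇒contained fc′) 𝒜 (proj₁ sep)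
    (FC-diag⇒contained fc 𝒜 (separated-kk 𝒜 (ℕ.≤-trans (ℕ.m≤m+n k k′) (proj₁ sep))))

-- Induction on the order, starting from 1

positive-induction : (P : ℕ → Set) → P 1 → (∀ {k} → 1 ≤ k → P k → P (suc k)) → ∀ {k} → 1 ≤ k → P k
positive-induction P base step {suc zero}    _ = base
positive-induction P base step {suc (suc k)} _ =
  step (s≤s z≤n) (positive-induction P base step (s≤s z≤n))

theorem5 : (k k′ : ℕ) → 1 ≤ k → 1 ≤ k′ →
    ((FC k 1 → FC k′ 1 → FC (k + k′) 1) × (FranklConjecture → FC k 1)) ×
    ((FC k k → FC k′ k′ → FC (k + k′) (k + k′)) × (FranklConjecture → FC k k))
theorem5 k k′ 1≤k 1≤k′ =
  ( FC-1-+ 1≤k 1≤k′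
  -- The order 1 is added on the left, so that `1 + k` computes to `suc k`.
  , λ frankl → positive-induction (λ k → FC k 1) (frankl⇒FC-11 frankl)
      (λ 1≤k → FC-1-+ ℕ.≤-refl 1≤k (frankl⇒FC-11 frankl)) 1≤k ) ,
  ( FC-diag-+ 1≤k′
  , λ frankl → positive-induction (λ k → FC k k) (frankl⇒FC-11 frankl)
      (λ 1≤k → FC-diag-+ 1≤k (frankl⇒FC-11 frankl)) 1≤k )
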